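{- Let $\Sigma$ be a signed graph and let $\mathrm{acyc}_\Sigma(k)$ be the number of acyclic orientations of $\Sigma$ with exactly $k$ sinks. Then $X_\Sigma\in\mathbb{Y}$ and $\phi(X_\Sigma)=\sum_{k\ge0}\mathrm{acyc}_\Sigma(k)t^k$.
   Context: A signed graph $\Sigma$ is a finite graph (loops and multiple edges allowed) with $\mathrm{sgn}:E(\Sigma)\to\{+,-\}$; write $e:uv$ if $e$ has endpoints $u,v$. A coloring $\kappa:V(\Sigma)\to\mathbb{Z}$ is proper if $\kappa(u)\ne\mathrm{sgn}(e)\kappa(v)$ for every edge $e:uv$; $X_\Sigma=\sum_{\kappa\text{ proper}}\prod_{v}x_{\kappa(v)}$ in variables $x_i$, $i\in\mathbb{Z}$. An orientation assigns to each half-edge (a loop has two) an arrow toward or away from the vertex, such that on a positive edge exactly one of the two arrows points toward its vertex and on a negative edge both point toward or both point away. A cycle is a closed walk in which, considering only the edges of the walk, every vertex of the walk has at least one arrow pointing into it and one pointing out of it; an orientation is acyclic if it has no cycle; a sink is a vertex all of whose incident arrows point toward it (an isolated vertex is a sink). A signed poset is an acyclic orientation $P$ of a signed graph. A proper coloring $\kappa$ preserves $P$ if for every edge $e$ and each endpoint $v$ of $e$, with $u$ the other endpoint ($u=v$ for a loop), the arrow of $P$ at the incidence of $e$ with $v$ points toward $v$ iff $\kappa(v)>\mathrm{sgn}(e)\kappa(u)$. $Y_P=\sum_\kappa\prod_v x_{\kappa(v)}$ over proper colorings preserving $P$; $\mathbb{Y}$ is the $\mathbb{Q}$-span of all $Y_P$.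 $\phi:\mathbb{Y}\to\mathbb{Q}[t]$ is the (unique) $\mathbb{Q}$-linear map with $\phi(Y_P)=t^{\mathrm{sink}(P)}$ for every signed poset $P$ (its existence is established in the paper). -}

module Defs where

open import Level using (0ℓ)
open import Algebra.Bundles using (Ring; CommutativeRing)
open import Algebra.Module.Bundles using (LeftModule)
open import Algebra.Module.Morphism.Structures using (IsLeftModuleHomomorphism)
open import Data.Bool.Base using (true; false; if_then_else_; T)
open import Data.Fin.Base using (Fin; zero; suc; opposite)
import Data.Fin.Properties as Fin
open import Data.Fin.Subset using (Subset; ⁅_⁆; _∪_; ⊥) renaming (_∈_ to _∈ₛ_)
import Data.Fin.Subset.Properties as Subset
open import Data.Integer.Base using (ℤ; +_; ∣_∣)
import Data.Integer.Base as ℤ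
import Data.Integer.Properties as ℤ
open import Data.List.Base
  using (List; []; _∷_; _++_; map; foldr; filter; length; upTo; allFin; cartesianProduct; cartesianProductWith)
open import Data.List.Membership.Propositional using (_∈_)
open import Data.List.Membership.Propositional.Properties
  using (∈-∃++; ∈-allFin; ∈-cartesianProduct⁺; ∈-cartesianProductWith⁺)
import Data.List.Properties as List
open import Data.List.Relation.Binary.Permutation.Propositional
  using (_↭_; ↭-refl; ↭-sym; ↭-trans; prep)
open import Data.List.Relation.Binary.Permutation.Propositional.Properties
  using (shift; drop-∷; ∈-resp-↭; ¬x∷xs↭[]) renaming (map⁺ to ↭-map)
open import Data.List.Relation.Unary.All using (universal)
open import Data.List.Relation.Unary.Any using (here; there)
open import Data.Nat.Base using (ℕ; suc; _≤_; _⊔_)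
import Data.Nat.Base as ℕ
open import Data.Nat.ListAction using (sum)
open import Data.Nat.ListAction.Properties using (sum-↭)
import Data.Nat.Properties as ℕ
open import Data.Product using (Σ; ∃; ∃₂; _×_; _,_; proj₁; proj₂)
open import Data.Rational.Base using (ℚ; 0ℚ; 1ℚ)
import Data.Rational.Base as ℚ
open import Data.Rational.Literals using (fromℤ)
import Data.Rational.Properties as ℚ
open import Data.Sign.Base using (Sign)
open import Data.Sum using (_⊎_; inj₁; inj₂)
open import Data.Vec.Base using (Vec; []; _∷_; lookup; toList)
open import Function.Base using (_∘_)
open import Function.Bundles using (_⇔_; mk⇔; Equivalence)
open import Relation.Binary.Core using (Rel)
open import Relation.Binary.Construct.Closure.ReflexiveTransitive using (Star; ε; _◅_; _◅◅_)
import Relation.Binary.Definitions as Binary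
open import Relation.Binary.PropositionalEquality
  using (_≡_; _≢_; _≗_; refl; sym; trans; cong; cong₂; subst)
open import Relation.Nullary using (¬_; Dec; yes; no; does)
open import Relation.Nullary.Decidable using (_×-dec_; _⊎-dec_; _→-dec_; ¬?; map′)
open import Relation.Unary using (Decidable)

ℚ-ring : Ring 0ℓ 0ℓ
ℚ-ring = CommutativeRing.ring ℚ.+-*-commutativeRing

ℚ-Space : Set₁
ℚ-Space = LeftModule ℚ-ring 0ℓ 0ℓ

∣_∣ᴹ : ℚ-Space → Set
∣ M ∣ᴹ = LeftModule.Carrierᴹ M

_⊢_≈_ : (M : ℚ-Space) → ∣ M ∣ᴹ → ∣ M ∣ᴹ → Set
M ⊢ x ≈ y = LeftModule._≈ᴹ_ M x y

IsLinear : (M N : ℚ-Space) → (∣ M ∣ᴹ → ∣ N ∣ᴹ) → Set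
IsLinear M N = IsLeftModuleHomomorphism (LeftModule.rawLeftModule M) (LeftModule.rawLeftModule N)

ℚ^ : Set → ℚ-Space
ℚ^ I = record
  { Carrierᴹ = I → ℚ
  ; _≈ᴹ_ = _≗_
  ; _+ᴹ_ = λ f g i → f i ℚ.+ g i
  ; _*ₗ_ = λ q f i → q ℚ.* f i
  ; 0ᴹ = λ _ → 0ℚ
  ; -ᴹ_ = λ f i → ℚ.- f i
  ; isLeftModule = record
    { isLeftSemimodule = record
      { +ᴹ-isCommutativeMonoid = record
        { isMonoid = record
          { isSemigroup = record
            { isMagma = record
              { isEquivalence = record
                { refl = λ _ → refl
                ; sym = λ p i → sym (p i)
                ; trans = λ p q i → trans (p i) (q i)
                }
              ; ∙-cong = λ p q i → cong₂ ℚ._+_ (p i) (q i)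
              }
            ; assoc = λ f g h i → ℚ.+-assoc (f i) (g i) (h i)
            }
          ; identity = (λ f i → ℚ.+-identityˡ (f i)) , (λ f i → ℚ.+-identityʳ (f i))
          }
        ; comm = λ f g i → ℚ.+-comm (f i) (g i)
        }
      ; isPreleftSemimodule = record
        { *ₗ-cong = λ p q i → cong₂ ℚ._*_ p (q i)
        ; *ₗ-zeroˡ = λ f i → ℚ.*-zeroˡ (f i)
        ; *ₗ-distribʳ = λ f p q i → ℚ.*-distribʳ-+ (f i) p q
        ; *ₗ-identityˡ = λ f i → ℚ.*-identityˡ (f i)
        ; *ₗ-assoc = λ p q f i → ℚ.*-assoc p q (f i)
        ; *ₗ-zeroʳ = λ p i → ℚ.*-zeroʳ p
        ; *ₗ-distribˡ = λ p f g i → ℚ.*-distribˡ-+ p (f i) (g i)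
        }
      }
    ; -ᴹ‿cong = λ p i → cong ℚ.-_ (p i)
    ; -ᴹ‿inverse = (λ f i → ℚ.+-inverseˡ (f i)) , (λ f i → ℚ.+-inverseʳ (f i))
    }
  }

record Subspace (M : ℚ-Space) : Set₁ where
  open LeftModule M
  field
    Member   : Carrierᴹ → Set
    +-closed : ∀ {x y} → Member x → Member y → Member (x +ᴹ y)
    *-closed : ∀ q {x} → Member x → Member (q *ₗ x)
    0-closed : Member 0ᴹ
    neg-closed : ∀ {x} → Member x → Member (-ᴹ x)

  space : ℚ-Space
  space = record
    { Carrierᴹ = Σ Carrierᴹ Member
    ; _≈ᴹ_ = λ x y → proj₁ x ≈ᴹ proj₁ y
    ; _+ᴹ_ = λ x y → (proj₁ x +ᴹ proj₁ y) , +-closed (proj₂ x) (proj₂ y)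
    ; _*ₗ_ = λ q x → (q *ₗ proj₁ x) , *-closed q (proj₂ x)
    ; 0ᴹ = 0ᴹ , 0-closed
    ; -ᴹ_ = λ x → (-ᴹ proj₁ x) , neg-closed (proj₂ x)
    ; isLeftModule = record
      { isLeftSemimodule = record
        { +ᴹ-isCommutativeMonoid = record
          { isMonoid = record
            { isSemigroup = record
              { isMagma = record
                { isEquivalence = record { refl = ≈ᴹ-refl ; sym = ≈ᴹ-sym ; trans = ≈ᴹ-trans }
                ; ∙-cong = +ᴹ-cong
                }
              ; assoc = λ x y z → +ᴹ-assoc (proj₁ x) (proj₁ y) (proj₁ z)
              }
            ; identity = (λ x → +ᴹ-identityˡ (proj₁ x)) , (λ x → +ᴹ-identityʳ (proj₁ x))
            }
          ; comm = λ x y → +ᴹ-comm (proj₁ x) (proj₁ y)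
          }
        ; isPreleftSemimodule = record
          { *ₗ-cong = *ₗ-cong
          ; *ₗ-zeroˡ = λ x → *ₗ-zeroˡ (proj₁ x)
          ; *ₗ-distribʳ = λ x p q → *ₗ-distribʳ (proj₁ x) p q
          ; *ₗ-identityˡ = λ x → *ₗ-identityˡ (proj₁ x)
          ; *ₗ-assoc = λ p q x → *ₗ-assoc p q (proj₁ x)
          ; *ₗ-zeroʳ = *ₗ-zeroʳ
          ; *ₗ-distribˡ = λ p x y → *ₗ-distribˡ p (proj₁ x) (proj₁ y)
          }
        }
      ; -ᴹ‿cong = -ᴹ‿cong
      ; -ᴹ‿inverse = (λ x → -ᴹ‿inverseˡ (proj₁ x)) , (λ x → -ᴹ‿inverseʳ (proj₁ x))
      }
    }

open Subspace public using (space)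

module _ (M : ℚ-Space) {I : Set} (v : I → ∣ M ∣ᴹ) where
  open LeftModule M

  combination : List (ℚ × I) → Carrierᴹ
  combination = foldr (λ (q , i) x → q *ₗ v i +ᴹ x) 0ᴹ

  InSpan : Carrierᴹ → Set
  InSpan x = ∃ λ ts → x ≈ᴹ combination ts

  private
    combination-++ : ∀ ss ts → combination ss +ᴹ combination ts ≈ᴹ combination (ss ++ ts)
    combination-++ [] ts = +ᴹ-identityˡ _
    combination-++ ((q , i) ∷ ss) ts =
      ≈ᴹ-trans (+ᴹ-assoc _ _ _) (+ᴹ-cong ≈ᴹ-refl (combination-++ ss ts))

    combination-* : ∀ p ts →
      p *ₗ combination ts ≈ᴹ combination (map (λ (q , i) → p ℚ.* q , i) ts)
    combination-* p [] = *ₗ-zeroʳ p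
    combination-* p ((q , i) ∷ ts) =
      ≈ᴹ-trans (*ₗ-distribˡ p _ _) (+ᴹ-cong (≈ᴹ-sym (*ₗ-assoc p q _)) (combination-* p ts))

    *-inSpan : ∀ p {x} → InSpan x → InSpan (p *ₗ x)
    *-inSpan p (ts , eq) = map (λ (q , i) → p ℚ.* q , i) ts , ≈ᴹ-trans (*ₗ-cong refl eq) (combination-* p ts)

    -1*x≈-x : ∀ x → (ℚ.- 1ℚ) *ₗ x ≈ᴹ -ᴹ x
    -1*x≈-x x = uniqueʳ‿-ᴹ x ((ℚ.- 1ℚ) *ₗ x)
      (≈ᴹ-trans (+ᴹ-cong (≈ᴹ-sym (*ₗ-identityˡ x)) ≈ᴹ-refl)
        (≈ᴹ-trans (≈ᴹ-sym (*ₗ-distribʳ x 1ℚ (ℚ.- 1ℚ))) (*ₗ-zeroˡ x)))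

  span : Subspace M
  span = record
    { Member = InSpan
    ; +-closed = λ (ss , p) (ts , q) → ss ++ ts , ≈ᴹ-trans (+ᴹ-cong p q) (combination-++ ss ts)
    ; *-closed = *-inSpan
    ; 0-closed = [] , ≈ᴹ-refl
    ; neg-closed = λ {x} x∈ → let (ts , eq) = *-inSpan (ℚ.- 1ℚ) x∈ in
        ts , ≈ᴹ-trans (≈ᴹ-sym (-1*x≈-x x)) eq
    }

  abstract
    generator∈span : ∀ i → InSpan (v i)
    generator∈span i = (1ℚ , i) ∷ [] ,
      ≈ᴹ-sym (≈ᴹ-trans (+ᴹ-identityʳ _) (*ₗ-identityˡ (v i)))

fromℕ : ℕ → ℚ
fromℕ n = fromℤ (+ n)

-- A monomial is a finite multiset of variables: the list i₁ ∷ … ∷ iₙ, up to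
-- permutation, stands for xᵢ₁⋯xᵢₙ.
Monomial : Set
Monomial = List ℤ

-- A power series assigns to each monomial its coefficient.
PowerSeries : ℚ-Space
PowerSeries = space {M = ℚ^ Monomial} record
  { Member = λ f → ∀ {m m′} → m ↭ m′ → f m ≡ f m′
  ; +-closed = λ p q r → cong₂ ℚ._+_ (p r) (q r)
  ; *-closed = λ q p r → cong (q ℚ.*_) (p r)
  ; 0-closed = λ _ → refl
  ; neg-closed = λ p r → cong ℚ.-_ (p r)
  }

_↭?_ : Binary.Decidable (_↭_ {A = ℤ})
[]       ↭? []       = yes ↭-refl
[]       ↭? (y ∷ ys) = no (¬x∷xs↭[] ∘ ↭-sym)
(x ∷ xs) ↭? ys with x ∈? ys
  where open import Data.List.Membership.DecPropositional ℤ._≟_ using (_∈?_)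
... | no x∉ys = no λ p → x∉ys (∈-resp-↭ p (here refl))
... | yes x∈ys with ∈-∃++ x∈ys
...   | as , bs , refl = map′ (λ p → ↭-trans (prep x p) (↭-sym (shift x as bs)))
                              (λ p → drop-∷ (↭-trans p (shift x as bs)))
                              (xs ↭? (as ++ bs))

vectors : {A : Set} → List A → (n : ℕ) → List (Vec A n)
vectors xs 0       = [] ∷ []
vectors xs (suc n) = cartesianProductWith _∷_ xs (vectors xs n)

-- [-b , … , b]
interval : ℕ → List ℤ
interval b = map (λ i → + i ℤ.- + b) (upTo (suc (b ℕ.+ b)))

-- Every i occurring in m satisfies ∣ i ∣ ≤ size m.
size : Monomial → ℕ
size m = sum (map ∣_∣ m)

-- The sum of ∏ᵥ x_{κ(v)} over all κ : Fin n → ℤ satisfying Q.  The coefficient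
-- of m counts the κ with Q κ whose monomial is m; all of these have entries in
-- interval (size m), so searching that box loses nothing.
colouringSum : ∀ {n} {Q : Vec ℤ n → Set} → Decidable Q → ∣ PowerSeries ∣ᴹ
colouringSum {n} {Q} Q? = (λ m → fromℕ (count m)) , λ p → cong fromℕ (count-cong p)
  where
  contributes? : ∀ m → Decidable (λ κ → Q κ × toList κ ↭ m)
  contributes? m κ = Q? κ ×-dec (toList κ ↭? m)

  count : Monomial → ℕ
  count m = length (filter (contributes? m) (vectors (interval (size m)) n))

  count-cong : ∀ {m m′} → m ↭ m′ → count m ≡ count m′
  count-cong {m} {m′} p = trans
    (cong (λ b → length (filter (contributes? m) (vectors (interval b) n))) (sum-↭ (↭-map ∣_∣ p)))
    (cong length (List.filter-≐ (contributes? m) (contributes? m′)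
      ((λ (a , b) → a , ↭-trans b p) , (λ (a , b) → a , ↭-trans b (↭-sym p)))
      (vectors (interval (size m′)) n)))

-- Polynomials are finitely supported coefficient functions.
ℚ[t] : ℚ-Space
ℚ[t] = space {M = ℚ^ ℕ} record
  { Member = λ f → ∃ λ d → ∀ k → d ≤ k → f k ≡ 0ℚ
  ; +-closed = λ (d , p) (e , q) → d ⊔ e , λ k d⊔e≤k →
      cong₂ ℚ._+_ (p k (ℕ.≤-trans (ℕ.m≤m⊔n d e) d⊔e≤k)) (q k (ℕ.≤-trans (ℕ.m≤n⊔m d e) d⊔e≤k))
  ; *-closed = λ q (d , p) → d , λ k d≤k → trans (cong (q ℚ.*_) (p k d≤k)) (ℚ.*-zeroʳ q)
  ; 0-closed = 0 , λ _ _ → refl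
  ; neg-closed = λ (d , p) → d , λ k d≤k → cong ℚ.-_ (p k d≤k)
  }

t^_ : ℕ → ∣ ℚ[t] ∣ᴹ
t^ k = coeff , suc k , vanishes
  where
  coeff : ℕ → ℚ
  coeff j = if does (j ℕ.≟ k) then 1ℚ else 0ℚ

  vanishes : ∀ j → suc k ≤ j → coeff j ≡ 0ℚ
  vanishes j k<j with j ℕ.≡ᵇ k in eq
  ... | false = refl
  ... | true with refl ← ℕ.≡ᵇ⇒≡ j k (subst T (sym eq) _) with () ← ℕ.<-irrefl refl k<j

-- Each edge e has two half-edges (e , 0) and (e , 1), lying at the vertices
-- ends e 0 and ends e 1, which coincide when e is a loop.
record SignedGraph : Set where
  field
    #V   : ℕ
    #E   : ℕ
    ends : Fin #E → Fin 2 → Fin #V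
    sgn  : Fin #E → Sign

  Vertex Edge HalfEdge : Set
  Vertex   = Fin #V
  Edge     = Fin #E
  HalfEdge = Edge × Fin 2

  vertex : HalfEdge → Vertex
  vertex (e , s) = ends e s

  other : HalfEdge → HalfEdge
  other (e , s) = e , opposite s

open SignedGraph public

_·_ : Sign → ℤ → ℤ
Sign.+ · i = i
Sign.- · i = ℤ.- i

Colouring : SignedGraph → Set
Colouring G = Vec ℤ (#V G)

Proper : (G : SignedGraph) → Colouring G → Set
Proper G κ = ∀ e → lookup κ (ends G e zero) ≢ sgn G e · lookup κ (ends G e (suc zero))

proper? : ∀ G → Decidable (Proper G)
proper? G κ = Fin.all? λ e → ¬? (_ ℤ.≟ _)

X : SignedGraph → ∣ PowerSeries ∣ᴹ
X G = colouringSum (proper? G)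

data Arrow : Set where
  toward away : Arrow

_≟ᴬ_ : Binary.DecidableEquality Arrow
toward ≟ᴬ toward = yes refl
toward ≟ᴬ away   = no λ ()
away   ≟ᴬ toward = no λ ()
away   ≟ᴬ away   = yes refl

-- An arrow, relative to its vertex, on every half-edge.
Arrows : SignedGraph → Set
Arrows G = Vec (Vec Arrow 2) (#E G)

arrow : ∀ {G} → Arrows G → HalfEdge G → Arrow
arrow o (e , s) = lookup (lookup o e) s

Compatible : Sign → Arrow → Arrow → Set
Compatible Sign.+ a b = a ≢ b
Compatible Sign.- a b = a ≡ b

compatible? : ∀ s a b → Dec (Compatible s a b)
compatible? Sign.+ a b = ¬? (a ≟ᴬ b)
compatible? Sign.- a b = a ≟ᴬ b

module _ (G : SignedGraph) where

  IsOrientation : Arrows G → Set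
  IsOrientation o = ∀ e → Compatible (sgn G e) (arrow {G} o (e , zero)) (arrow {G} o (e , suc zero))

  isOrientation? : Decidable IsOrientation
  isOrientation? o = Fin.all? λ e → compatible? _ _ _

  -- The half-edges along which a walk leaves its successive vertices.
  IsWalk : Vertex G → List (HalfEdge G) → Vertex G → Set
  IsWalk u []       w = u ≡ w
  IsWalk u (h ∷ hs) w = vertex G h ≡ u × IsWalk (vertex G (other G h)) hs w

  walkVertices : Vertex G → List (HalfEdge G) → List (Vertex G)
  walkVertices u hs = u ∷ map (vertex G ∘ other G) hs

  walkEdges : List (HalfEdge G) → List (Edge G)
  walkEdges = map proj₁

  module _ (o : Arrows G) where

    HasArrow : Arrow → (Edge G → Set) → Vertex G → Set
    HasArrow a S v = ∃ λ h → S (proj₁ h) × vertex G h ≡ v × arrow {G} o h ≡ a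

    -- The walk with no edges is excluded: its vertex has no arrows.
    IsCycle : Vertex G → List (HalfEdge G) → Set
    IsCycle u hs = IsWalk u hs u ×
      (∀ v → v ∈ walkVertices u hs →
        HasArrow toward (_∈ walkEdges hs) v × HasArrow away (_∈ walkEdges hs) v)

    Acyclic : Set
    Acyclic = ¬ ∃₂ IsCycle

    IsSink : Vertex G → Set
    IsSink v = ∀ e s → vertex G (e , s) ≡ v → arrow {G} o (e , s) ≡ toward

    isSink? : Decidable IsSink
    isSink? v = Fin.all? λ e → Fin.all? λ s → (_ Fin.≟ _) →-dec (_ ≟ᴬ _)

    sinkCount : ℕ
    sinkCount = length (filter isSink? (allFin (#V G)))

-- Acyclicity is decidable: whether a closed walk is a cycle depends only on
-- the sets of vertices and edges it visits, so it is enough to decide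
-- reachability between the finitely many triples (vertex, visited vertices,
-- visited edges).

module Reachability {A : Set} {R : Rel A 0ℓ} (R? : Binary.Decidable R)
                    (_≟_ : Binary.DecidableEquality A)
                    (points : List A) (complete : ∀ a → a ∈ points) where
  private
    -- Paths all of whose intermediate points are in the list.
    Reach : List A → Rel A 0ℓ
    Reach []       a b = a ≡ b ⊎ R a b
    Reach (c ∷ cs) a b = Reach cs a b ⊎ (Reach cs a c × Reach cs c b)

    reach? : ∀ cs → Binary.Decidable (Reach cs)
    reach? []       a b = (a ≟ b) ⊎-dec R? a b
    reach? (c ∷ cs) a b = reach? cs a b ⊎-dec (reach? cs a c ×-dec reach? cs c b)

    reach-refl : ∀ cs {a} → Reach cs a a
    reach-refl []       = inj₁ refl
    reach-refl (c ∷ cs) = inj₁ (reach-refl cs)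

    reach-step : ∀ cs {a b} → R a b → Reach cs a b
    reach-step []       r = inj₂ r
    reach-step (c ∷ cs) r = inj₁ (reach-step cs r)

    reach-trans : ∀ cs {a b c} → c ∈ cs → Reach cs a c → Reach cs c b → Reach cs a b
    reach-trans (c ∷ cs) (here refl) p q = inj₂ (source p , target q)
      where
      source : ∀ {a} → Reach (c ∷ cs) a c → Reach cs a c
      source (inj₁ p)       = p
      source (inj₂ (p , _)) = p
      target : ∀ {b} → Reach (c ∷ cs) c b → Reach cs c b
      target (inj₁ p)       = p
      target (inj₂ (_ , p)) = p
    reach-trans (_ ∷ cs) (there c∈) (inj₁ p)        (inj₁ q)        = inj₁ (reach-trans cs c∈ p q)
    reach-trans (_ ∷ cs) (there c∈) (inj₁ p)        (inj₂ (q , q′)) = inj₂ (reach-trans cs c∈ p q , q′)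
    reach-trans (_ ∷ cs) (there c∈) (inj₂ (p , p′)) (inj₁ q)        = inj₂ (p , reach-trans cs c∈ p′ q)
    reach-trans (_ ∷ cs) (there c∈) (inj₂ (p , _))  (inj₂ (_ , q))  = inj₂ (p , q)

    reach⇒star : ∀ cs {a b} → Reach cs a b → Star R a b
    reach⇒star []       (inj₁ refl)    = ε
    reach⇒star []       (inj₂ r)       = r ◅ ε
    reach⇒star (c ∷ cs) (inj₁ p)       = reach⇒star cs p
    reach⇒star (c ∷ cs) (inj₂ (p , q)) = reach⇒star cs p ◅◅ reach⇒star cs q

    star⇒reach : ∀ {a b} → Star R a b → Reach points a b
    star⇒reach ε        = reach-refl points
    star⇒reach (r ◅ rs) = reach-trans points (complete _) (reach-step points r) (star⇒reach rs)

  star? : Binary.Decidable (Star R)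
  star? a b = map′ (reach⇒star points) star⇒reach (reach? points a b)

vectors-complete : ∀ {A : Set} {xs : List A} → (∀ x → x ∈ xs) → ∀ {n} (v : Vec A n) → v ∈ vectors xs n
vectors-complete all []      = here refl
vectors-complete all (x ∷ v) = ∈-cartesianProductWith⁺ _∷_ (all x) (vectors-complete all v)

module _ (G : SignedGraph) (o : Arrows G) where
  private
    State : Set
    State = Vertex G × Subset (#V G) × Subset (#E G)

    _≟ₛ_ : Binary.DecidableEquality State
    _≟ₛ_ = ≡-dec Fin._≟_ (≡-dec (Vec.≡-dec Bool._≟_) (Vec.≡-dec Bool._≟_))
      where
      open import Data.Product.Properties using (≡-dec)
      import Data.Vec.Properties as Vec
      import Data.Bool.Properties as Bool

    next : HalfEdge G → State → State
    next h (_ , W , S) = vertex G (other G h) , ⁅ vertex G (other G h) ⁆ ∪ W , ⁅ proj₁ h ⁆ ∪ S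

    Step : Rel State 0ℓ
    Step x y = ∃ λ h → vertex G h ≡ proj₁ x × y ≡ next h x

    step? : Binary.Decidable Step
    step? x y = map′ (λ (e , s , p) → (e , s) , p) (λ ((e , s) , p) → e , s , p)
      (Fin.any? λ e → Fin.any? λ s → (_ Fin.≟ _) ×-dec (y ≟ₛ next (e , s) x))

    subsets : ∀ n → List (Subset n)
    subsets = vectors (true ∷ false ∷ [])

    subsets-complete : ∀ {n} (S : Subset n) → S ∈ subsets n
    subsets-complete = vectors-complete λ { true → here refl ; false → there (here refl) }

    states : List State
    states = cartesianProduct (allFin _) (cartesianProduct (subsets _) (subsets _))

    states-complete : ∀ x → x ∈ states
    states-complete (v , W , S) =
      ∈-cartesianProduct⁺ (∈-allFin v) (∈-cartesianProduct⁺ (subsets-complete W) (subsets-complete S))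

    open Reachability step? _≟ₛ_ states states-complete

    Extends : ∀ {n} → Subset n → List (Fin n) → Subset n → Set
    Extends S xs S′ = ∀ x → x ∈ₛ S′ ⇔ (x ∈ₛ S ⊎ x ∈ xs)

    extends-[] : ∀ {n} {S : Subset n} → Extends S [] S
    extends-[] x = mk⇔ inj₁ λ { (inj₁ p) → p ; (inj₂ ()) }

    extends-one : ∀ {n} {S : Subset n} y → Extends S (y ∷ []) (⁅ y ⁆ ∪ S)
    extends-one {S = S} y x = mk⇔ to from
      where
      to : x ∈ₛ ⁅ y ⁆ ∪ S → x ∈ₛ S ⊎ x ∈ (y ∷ [])
      to p with Subset.x∈p∪q⁻ ⁅ y ⁆ S p
      ... | inj₁ q = inj₂ (here (Subset.x∈⁅y⁆⇒x≡y y q))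
      ... | inj₂ q = inj₁ q
      from : x ∈ₛ S ⊎ x ∈ (y ∷ []) → x ∈ₛ ⁅ y ⁆ ∪ S
      from (inj₁ p)           = Subset.x∈p∪q⁺ (inj₂ p)
      from (inj₂ (here refl)) = Subset.x∈p∪q⁺ (inj₁ (Subset.x∈⁅x⁆ y))

    extends-++ : ∀ {n} {S S′ S″ : Subset n} xs {ys} →
      Extends S xs S′ → Extends S′ ys S″ → Extends S (xs ++ ys) S″
    extends-++ {S = S} {S″ = S″} xs {ys} p q x = mk⇔ to from
      where
      open import Data.List.Membership.Propositional.Properties using (∈-++⁺ˡ; ∈-++⁺ʳ; ∈-++⁻)
      to : x ∈ₛ S″ → x ∈ₛ S ⊎ x ∈ xs ++ ys
      to r with Equivalence.to (q x) r
      ... | inj₂ x∈ys = inj₂ (∈-++⁺ʳ xs x∈ys)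
      ... | inj₁ x∈S′ with Equivalence.to (p x) x∈S′
      ...   | inj₁ x∈S  = inj₁ x∈S
      ...   | inj₂ x∈xs = inj₂ (∈-++⁺ˡ x∈xs)
      from : x ∈ₛ S ⊎ x ∈ xs ++ ys → x ∈ₛ S″
      from (inj₁ x∈S) = Equivalence.from (q x) (inj₁ (Equivalence.from (p x) (inj₁ x∈S)))
      from (inj₂ r) with ∈-++⁻ xs r
      ... | inj₁ x∈xs = Equivalence.from (q x) (inj₁ (Equivalence.from (p x) (inj₂ x∈xs)))
      ... | inj₂ x∈ys = Equivalence.from (q x) (inj₂ x∈ys)

    targets : List (HalfEdge G) → List (Vertex G)
    targets = map (vertex G ∘ other G)

    Walks : List (HalfEdge G) → Rel State 0ℓ
    Walks hs (u , W , S) (v , W′ , S′) =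
      IsWalk G u hs v × Extends W (targets hs) W′ × Extends S (walkEdges G hs) S′

    star⇒walk : ∀ {x y} → Star Step x y → ∃ λ hs → Walks hs x y
    star⇒walk ε = [] , refl , extends-[] , extends-[]
    star⇒walk ((h , e , refl) ◅ rs) with star⇒walk rs
    ... | hs , p , q , q′ =
      h ∷ hs , (e , p) , extends-++ (_ ∷ []) (extends-one _) q , extends-++ (_ ∷ []) (extends-one _) q′

    walk⇒star : ∀ {u v W S} hs → IsWalk G u hs v →
      ∃₂ λ W′ S′ → Star Step (u , W , S) (v , W′ , S′) × Walks hs (u , W , S) (v , W′ , S′)
    walk⇒star []       refl    = _ , _ , ε , refl , extends-[] , extends-[]
    walk⇒star (h ∷ hs) (e , p) with walk⇒star hs p
    ... | W′ , S′ , r , _ , q , q′ =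
      W′ , S′ , (h , e , refl) ◅ r , (e , p) ,
      extends-++ (_ ∷ []) (extends-one _) q , extends-++ (_ ∷ []) (extends-one _) q′

    Balanced : (Vertex G → Set) → (Edge G → Set) → Set
    Balanced W S = ∀ v → W v → HasArrow G o toward S v × HasArrow G o away S v

    balanced-mono : ∀ {W W′ S S′} → (∀ {v} → W′ v → W v) → (∀ {e} → S e → S′ e) →
      Balanced W S → Balanced W′ S′
    balanced-mono f g b v w with b v (f w)
    ... | (h , s , p) , (h′ , s′ , p′) = (h , g s , p) , (h′ , g s′ , p′)

    Cyclic : Set
    Cyclic = ∃ λ u → ∃ λ (WS : Subset (#V G) × Subset (#E G)) →
      Star Step (u , ⁅ u ⁆ , ⊥) (u , WS) × Balanced (_∈ₛ proj₁ WS) (_∈ₛ proj₂ WS)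

    cyclic? : Dec Cyclic
    cyclic? = Fin.any? λ u →
      map′ (λ (W , S , p) → (W , S) , p) (λ ((W , S) , p) → W , S , p)
        (Subset.anySubset? λ W → Subset.anySubset? λ S →
          star? _ _ ×-dec
          Fin.all? λ v → (v Subset.∈? W) →-dec (hasArrow? toward S v ×-dec hasArrow? away S v))
      where
      hasArrow? : ∀ a S v → Dec (HasArrow G o a (_∈ₛ S) v)
      hasArrow? a S v = map′ (λ (e , s , p) → (e , s) , p) (λ ((e , s) , p) → e , s , p)
        (Fin.any? λ e → Fin.any? λ s → (e Subset.∈? S) ×-dec (_ Fin.≟ _) ×-dec (_ ≟ᴬ _))

    cyclic⇒cycle : Cyclic → ∃₂ (IsCycle G o)
    cyclic⇒cycle (u , (W , S) , r , b) with star⇒walk r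
    ... | hs , w , p , q = u , hs , w , balanced-mono
      (λ { {v} (here refl) → Equivalence.from (p v) (inj₁ (Subset.x∈⁅x⁆ v))
         ; {v} (there v∈)  → Equivalence.from (p v) (inj₂ v∈) })
      (λ {e} e∈S → visited e (Equivalence.to (q e) e∈S)) b
      where
      visited : ∀ e → e ∈ₛ ⊥ ⊎ e ∈ walkEdges G hs → e ∈ walkEdges G hs
      visited e (inj₁ e∈⊥) with () ← Subset.∉⊥ e∈⊥
      visited e (inj₂ e∈)  = e∈

    cycle⇒cyclic : ∃₂ (IsCycle G o) → Cyclic
    cycle⇒cyclic (u , hs , w , b) with walk⇒star {W = ⁅ u ⁆} {S = ⊥} hs w
    ... | W , S , r , _ , p , q = u , (W , S) , r , balanced-mono
      (λ {v} v∈W → visited v (Equivalence.to (p v) v∈W))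
      (λ {e} e∈ → Equivalence.from (q e) (inj₂ e∈)) b
      where
      visited : ∀ v → v ∈ₛ ⁅ u ⁆ ⊎ v ∈ targets hs → v ∈ walkVertices G u hs
      visited v (inj₁ v∈) = here (Subset.x∈⁅y⁆⇒x≡y u v∈)
      visited v (inj₂ v∈) = there v∈

  acyclic? : Dec (Acyclic G o)
  acyclic? = ¬? (map′ cyclic⇒cycle cycle⇒cyclic cyclic?)

IsAcyclicWithSinks : ∀ G → ℕ → Arrows G → Set
IsAcyclicWithSinks G k o = IsOrientation G o × Acyclic G o × sinkCount G o ≡ k

isAcyclicWithSinks? : ∀ G k → Decidable (IsAcyclicWithSinks G k)
isAcyclicWithSinks? G k o =
  isOrientation? G o ×-dec acyclic? G o ×-dec (sinkCount G o ℕ.≟ k)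

allArrows : ∀ G → List (Arrows G)
allArrows G = vectors (vectors (toward ∷ away ∷ []) 2) (#E G)

acyc : SignedGraph → ℕ → ℕ
acyc G k = length (filter (isAcyclicWithSinks? G k) (allArrows G))

acycPolynomial : SignedGraph → ∣ ℚ[t] ∣ᴹ
acycPolynomial G = (λ k → fromℕ (acyc G k)) , suc (#V G) , λ k #V<k → cong fromℕ (vanishes k #V<k)
  where
  sinkCount≤#V : ∀ o → sinkCount G o ≤ #V G
  sinkCount≤#V o = ℕ.≤-trans (List.length-filter (isSink? G o) (allFin (#V G)))
                             (ℕ.≤-reflexive (List.length-tabulate {n = #V G} (λ i → i)))

  vanishes : ∀ k → suc (#V G) ≤ k → acyc G k ≡ 0
  vanishes k #V<k = cong length (List.filter-none (isAcyclicWithSinks? G k)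
    (universal (λ { o (_ , _ , refl) → ℕ.<⇒≱ #V<k (sinkCount≤#V o) }) (allArrows G)))

record SignedPoset : Set where
  field
    graph         : SignedGraph
    arrows        : Arrows graph
    isOrientation : IsOrientation graph arrows
    isAcyclic     : Acyclic graph arrows

open SignedPoset public

sink : SignedPoset → ℕ
sink P = sinkCount (graph P) (arrows P)

Preserves : (P : SignedPoset) → Colouring (graph P) → Set
Preserves P κ = ∀ e s →
  arrow {G} (arrows P) (e , s) ≡ toward ⇔
  sgn G e · lookup κ (vertex G (other G (e , s))) ℤ.< lookup κ (vertex G (e , s))
  where
  G : SignedGraph
  G = graph P

preserves? : ∀ P → Decidable (Preserves P)
preserves? P κ = Fin.all? λ e → Fin.all? λ s → (_ ≟ᴬ _) ⇔-dec (_ ℤ.<? _)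
  where
  _⇔-dec_ : {A B : Set} → Dec A → Dec B → Dec (A ⇔ B)
  a? ⇔-dec b? = map′ (λ (f , g) → mk⇔ f g) (λ e → Equivalence.to e , Equivalence.from e)
                     ((a? →-dec b?) ×-dec (b? →-dec a?))

Y : SignedPoset → ∣ PowerSeries ∣ᴹ
Y P = colouringSum (λ κ → proper? (graph P) κ ×-dec preserves? P κ)

Y-span : Subspace PowerSeries
Y-span = span PowerSeries Y

-- An element of 𝕐 carries a combination of Y's representing it, but equality
-- in 𝕐 is equality of power series, so a linear map out of 𝕐 cannot depend on
-- the chosen combination.
𝕐 : ℚ-Space
𝕐 = space {M = PowerSeries} Y-span

_∈𝕐 : ∣ PowerSeries ∣ᴹ → Set
F ∈𝕐 = InSpan PowerSeries Y F

Y∈𝕐 : ∀ P → Y P ∈𝕐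
Y∈𝕐 = generator∈span PowerSeries Y

-- These conditions determine φ, since the Y P span 𝕐.
IsSinkMap : (∣ 𝕐 ∣ᴹ → ∣ ℚ[t] ∣ᴹ) → Set
IsSinkMap φ = IsLinear 𝕐 ℚ[t] φ × (∀ P → ℚ[t] ⊢ φ (Y P , Y∈𝕐 P) ≈ (t^ sink P))

{-# OPTIONS --safe #-}
-- A proper colouring κ preserves exactly one orientation of Σ, the one it
-- induces, and that orientation is acyclic: a vertex with ∣ κ ∣ maximal on a cycle
-- lacks either an arrow in or an arrow out.  Hence X_Σ is the sum of Y_P over
-- the acyclic orientations P of Σ, and φ turns this sum into Σ_P t^sink(P).
module Submission where

open import Defs
open import Algebra.Module.Bundles using (LeftModule)
open import Algebra.Module.Morphism.Structures using (IsLeftModuleHomomorphism)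
open import Data.Bool.Base using (if_then_else_)
open import Data.Fin.Base using (zero; suc)
open import Data.Integer.Base using (ℤ; +_; ∣_∣)
import Data.Integer.Base as ℤ
import Data.Integer.Properties as ℤ
open import Data.List.Base using (List; []; _∷_; map; filter; length)
open import Data.List.Extrema.Nat using (argmax; argmax-sel; f[⊥]≤f[argmax]; f[xs]≤f[argmax])
open import Data.List.Membership.Propositional using (_∈_)
import Data.List.Membership.DecPropositional as DecMembership
import Data.List.Properties as List
open import Data.List.Relation.Binary.Permutation.Propositional using (_↭_)
open import Data.List.Relation.Unary.All using ([]; _∷_; universal)
import Data.List.Relation.Unary.All as All
open import Data.List.Relation.Unary.AllPairs using ([]; _∷_)
open import Data.List.Relation.Unary.Any using (here; there)
open import Data.List.Relation.Unary.Unique.Propositional using (Unique)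
open import Data.List.Relation.Unary.Unique.Propositional.Properties using (cartesianProductWith⁺)
open import Data.Nat.Base using (ℕ; suc; s≤s)
import Data.Nat.Base as ℕ
import Data.Nat.Properties as ℕ
open import Data.Product using (Σ; _×_; _,_; proj₁; proj₂)
open import Data.Rational.Base using (ℚ; 0ℚ; 1ℚ)
import Data.Rational.Base as ℚ
import Data.Rational.Properties as ℚ
import Data.Rational.Unnormalised.Base as ℚᵘ
import Data.Rational.Unnormalised.Properties as ℚᵘ
open import Data.Sign.Base using (Sign)
open import Data.Sum using (_⊎_; inj₁; inj₂; [_,_]′)
open import Data.Vec.Base using (Vec; []; _∷_; lookup; tabulate; toList)
import Data.Vec.Properties as Vec
open import Function.Base using (_∘_)
open import Function.Bundles using (_⇔_; mk⇔; Equivalence)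
open import Relation.Binary.Definitions using (DecidableEquality; tri<; tri≈; tri>)
open import Relation.Binary.PropositionalEquality
  using (_≡_; _≢_; refl; sym; trans; cong; cong₂; subst; subst₂)
open import Relation.Nullary using (¬_; Dec; yes; no; does; contradiction)
open import Relation.Nullary.Decidable using (_×-dec_; dec-true; dec-false)
open import Relation.Unary using (Decidable; _≐_)

open Equivalence using (to; from)

-- Counting: cardinalities as rationals, filters and repetition-free lists.

-- Addition in `ℚ` renormalises its result, so the equation does not hold by computation. Among
-- unnormalised rationals the two sides differ only by factors of 1.
fromℕ-+ : ∀ m n → fromℕ (m ℕ.+ n) ≡ fromℕ m ℚ.+ fromℕ n
fromℕ-+ m n = ℚ.toℚᵘ-injective (ℚᵘ.≃-trans
  (ℚᵘ.*≡* (cong (ℤ._* + 1) (sym (cong₂ ℤ._+_ (ℤ.*-identityʳ (+ m)) (ℤ.*-identityʳ (+ n))))))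
  (ℚᵘ.≃-sym (ℚ.toℚᵘ-homo-+ (fromℕ m) (fromℕ n))))

length-filter-⊎ : ∀ {A : Set} {P Q R : A → Set}
  (P? : Decidable P) (Q? : Decidable Q) (R? : Decidable R) →
  (∀ x → R x ⇔ (P x ⊎ Q x)) → (∀ x → P x → ¬ Q x) → ∀ xs →
  length (filter R? xs) ≡ length (filter P? xs) ℕ.+ length (filter Q? xs)
length-filter-⊎ P? Q? R? R⇔P⊎Q disjoint [] = refl
length-filter-⊎ P? Q? R? R⇔P⊎Q disjoint (x ∷ xs)
  with P? x | Q? x | R? x | length-filter-⊎ P? Q? R? R⇔P⊎Q disjoint xs
... | yes p | yes q | _     | _  = contradiction q (disjoint x p)
... | yes p | no ¬q | yes r | eq = cong suc eq
... | no ¬p | yes q | yes r | eq = trans (cong suc eq) (sym (ℕ.+-suc _ _))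
... | no ¬p | no ¬q | no ¬r | eq = eq
... | yes p | _     | no ¬r | _  = contradiction (from (R⇔P⊎Q x) (inj₁ p)) ¬r
... | no ¬p | yes q | no ¬r | _  = contradiction (from (R⇔P⊎Q x) (inj₂ q)) ¬r
... | no ¬p | no ¬q | yes r | _  = contradiction (to (R⇔P⊎Q x) r) [ ¬p , ¬q ]′

vectors-unique : ∀ {A : Set} {xs : List A} → Unique xs → ∀ n → Unique (vectors xs n)
vectors-unique u 0       = [] ∷ []
vectors-unique u (suc n) = cartesianProductWith⁺ _∷_ Vec.∷-injective u (vectors-unique u n)

lookup-ext : ∀ {A : Set} {n} {v w : Vec A n} → (∀ i → lookup v i ≡ lookup w i) → v ≡ w
lookup-ext {v = v} {w} eq = trans (sym (Vec.tabulate∘lookup v))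
  (trans (Vec.tabulate-cong eq) (Vec.tabulate∘lookup w))

-- Power series as sums over colourings.

module _ {n : ℕ} {P Q : Vec ℤ n → Set} (P? : Decidable P) (Q? : Decidable Q) where

  colouringSum-cong : P ≐ Q → PowerSeries ⊢ colouringSum P? ≈ colouringSum Q?
  colouringSum-cong (f , g) m = cong (fromℕ ∘ length)
    (List.filter-≐ _ _ ((λ (p , r) → f p , r) , (λ (q , r) → g q , r)) (vectors (interval (size m)) n))

  colouringSum-⊎ : ∀ {R : Vec ℤ n → Set} (R? : Decidable R) →
    (∀ κ → R κ ⇔ (P κ ⊎ Q κ)) → (∀ κ → P κ → ¬ Q κ) →
    PowerSeries ⊢ colouringSum R? ≈ LeftModule._+ᴹ_ PowerSeries (colouringSum P?) (colouringSum Q?)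
  colouringSum-⊎ R? R⇔P⊎Q disjoint m = trans
    (cong fromℕ (length-filter-⊎ (monomial? P?) (monomial? Q?) (monomial? R?)
      (λ κ → mk⇔ (λ (r , s) → [ (λ p → inj₁ (p , s)) , (λ q → inj₂ (q , s)) ]′ (to (R⇔P⊎Q κ) r))
                 [ (λ (p , s) → from (R⇔P⊎Q κ) (inj₁ p) , s) , (λ (q , s) → from (R⇔P⊎Q κ) (inj₂ q) , s) ]′)
      (λ κ (p , _) (q , _) → disjoint κ p q)
      box))
    (fromℕ-+ (length (filter (monomial? P?) box)) (length (filter (monomial? Q?) box)))
    where
    box : List (Vec ℤ n)
    box = vectors (interval (size m)) n

    monomial? : ∀ {S : Vec ℤ n → Set} → Decidable S → Decidable (λ κ → S κ × toList κ ↭ m)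
    monomial? S? κ = S? κ ×-dec (toList κ ↭? m)

colouringSum-none : ∀ {n} {P : Vec ℤ n → Set} (P? : Decidable P) → (∀ κ → ¬ P κ) →
  PowerSeries ⊢ colouringSum P? ≈ LeftModule.0ᴹ PowerSeries
colouringSum-none {n} P? none m = cong (fromℕ ∘ length)
  (List.filter-none _ (universal (λ κ (p , _) → none κ p) (vectors (interval (size m)) n)))

-- Coefficients of powers of t, and linear maps on a span.

t^-same : ∀ k → proj₁ (t^ k) k ≡ 1ℚ
t^-same k = cong (if_then 1ℚ else 0ℚ) (dec-true (k ℕ.≟ k) refl)

t^-other : ∀ {j k} → j ≢ k → proj₁ (t^ k) j ≡ 0ℚ
t^-other {j} {k} j≢k = cong (if_then 1ℚ else 0ℚ) (dec-false (j ℕ.≟ k) j≢k)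

module _ (M N : ℚ-Space) {I : Set} (v : I → ∣ M ∣ᴹ) (w : I → ∣ N ∣ᴹ)
         (φ : ∣ space (span M v) ∣ᴹ → ∣ N ∣ᴹ) (linear : IsLinear (space (span M v)) N φ)
         (φv≈w : ∀ i → N ⊢ φ (v i , generator∈span M v i) ≈ w i) where
  private
    module M = LeftModule M
    module N = LeftModule N
  open IsLeftModuleHomomorphism linear

  -- The witness `c` can be arbitrary: equality in the span compares only the vectors, so `⟦⟧-cong`
  -- at reflexivity replaces `c` by the witness that the closure operations build.
  linear-combination : ∀ ts (c : InSpan M v (combination M v ts)) →
    N ⊢ φ (combination M v ts , c) ≈ combination N w ts
  linear-combination []             c = N.≈ᴹ-trans (⟦⟧-cong M.≈ᴹ-refl) 0ᴹ-homo
  linear-combination ((q , i) ∷ ts) c =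
    N.≈ᴹ-trans (⟦⟧-cong M.≈ᴹ-refl)
      (N.≈ᴹ-trans (+ᴹ-homo (_ , Subspace.*-closed (span M v) q (generator∈span M v i)) (_ , rest))
        (N.+ᴹ-cong (N.≈ᴹ-trans (*ₗ-homo q _) (N.*ₗ-cong refl (φv≈w i)))
                   (linear-combination ts rest)))
    where
    rest : InSpan M v (combination M v ts)
    rest = ts , M.≈ᴹ-refl

  linear-inSpan : ∀ {x} (c : InSpan M v x) → N ⊢ φ (x , c) ≈ combination N w (proj₁ c)
  linear-inSpan (ts , eq) = N.≈ᴹ-trans (⟦⟧-cong eq) (linear-combination ts (ts , M.≈ᴹ-refl))

-- Signs, order and absolute value on the integers.

·-involutive : ∀ s i → s · (s · i) ≡ i
·-involutive Sign.+ i = refl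
·-involutive Sign.- i = ℤ.neg-involutive i

∣·∣ : ∀ s i → ∣ s · i ∣ ≡ ∣ i ∣
∣·∣ Sign.+ i = refl
∣·∣ Sign.- i = ℤ.∣-i∣≡∣i∣ i

-i<j⇒-j<i : ∀ i j → ℤ.- i ℤ.< j → ℤ.- j ℤ.< i
-i<j⇒-j<i i j = subst (ℤ.- j ℤ.<_) (ℤ.neg-involutive i) ∘ ℤ.neg-mono-<

-- Absolute value grows away from 0: if `j` is negative then `i` is farther out, otherwise `k` is.
∣∣-strictly-between : ∀ {i j k} → i ℤ.< j → j ℤ.< k → ∣ j ∣ ℕ.< ∣ i ∣ ⊎ ∣ j ∣ ℕ.< ∣ k ∣
∣∣-strictly-between (ℤ.-<- n<m) _           = inj₁ (s≤s n<m)
∣∣-strictly-between ℤ.-<+       (ℤ.+<+ m<n) = inj₂ m<n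
∣∣-strictly-between (ℤ.+<+ _)   (ℤ.+<+ m<n) = inj₂ m<n

arrowFrom : ℤ → ℤ → Arrow
arrowFrom i j = if does (i ℤ.<? j) then toward else away

arrowFrom-toward : ∀ i j → arrowFrom i j ≡ toward ⇔ i ℤ.< j
arrowFrom-toward i j with i ℤ.<? j
... | yes i<j = mk⇔ (λ _ → i<j) (λ _ → refl)
... | no  i≮j = mk⇔ (λ ()) (λ i<j → contradiction i<j i≮j)

-- By itself `away` only records that `i < j` fails; `j ≢ i` rules out the tie.
arrowFrom-away : ∀ i j → j ≢ i → arrowFrom i j ≡ away → j ℤ.< i
arrowFrom-away i j j≢i away≡ with ℤ.<-cmp i j
... | tri< i<j _ _ with () ← trans (sym away≡) (from (arrowFrom-toward i j) i<j)
... | tri≈ _ i≡j _ = contradiction (sym i≡j) j≢i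
... | tri> _ _ j<i = j<i

toward-injective : ∀ {a b} → (a ≡ toward ⇔ b ≡ toward) → a ≡ b
toward-injective {toward} {b}      eq = sym (to eq refl)
toward-injective {away}   {away}   eq = refl
toward-injective {away}   {toward} eq = from eq refl

-- On a positive edge, equal arrows would make both strict inequalities between `i` and `j` hold. On
-- a negative edge, negation turns `- j < i` into `- i < j` and back, so the arrows agree.
arrowFrom-compatible : ∀ s i j → i ≢ s · j → Compatible s (arrowFrom (s · j) i) (arrowFrom (s · i) j)
arrowFrom-compatible Sign.+ i j i≢j eq with arrowFrom i j in eqʳ
... | toward = ℤ.<-asym (to (arrowFrom-toward j i) eq) (to (arrowFrom-toward i j) eqʳ)
... | away   = ℤ.<-asym (arrowFrom-away j i i≢j eq) (arrowFrom-away i j (i≢j ∘ sym) eqʳ)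
arrowFrom-compatible Sign.- i j i≢-j = toward-injective (mk⇔
  (from (arrowFrom-toward _ _) ∘ -i<j⇒-j<i j i ∘ to (arrowFrom-toward _ _))
  (from (arrowFrom-toward _ _) ∘ -i<j⇒-j<i i j ∘ to (arrowFrom-toward _ _)))

-- The orientation induced by a proper colouring.

module _ (G : SignedGraph) where

  neighbourColour : Colouring G → HalfEdge G → ℤ
  neighbourColour κ h = sgn G (proj₁ h) · lookup κ (vertex G (other G h))

  inducedArrow : Colouring G → HalfEdge G → Arrow
  inducedArrow κ h = arrowFrom (neighbourColour κ h) (lookup κ (vertex G h))

  inducedArrows : Colouring G → Arrows G
  inducedArrows κ = tabulate λ e → tabulate λ s → inducedArrow κ (e , s)

  arrow-induced : ∀ κ h → arrow {G} (inducedArrows κ) h ≡ inducedArrow κ h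
  arrow-induced κ (e , s) = trans
    (cong (λ v → lookup v s) (Vec.lookup∘tabulate (λ e → tabulate λ s → inducedArrow κ (e , s)) e))
    (Vec.lookup∘tabulate (λ s → inducedArrow κ (e , s)) s)

  arrows-ext : ∀ {o o′ : Arrows G} → (∀ h → arrow {G} o h ≡ arrow {G} o′ h) → o ≡ o′
  arrows-ext eq = lookup-ext λ e → lookup-ext λ s → eq (e , s)

  arrow-toward : ∀ κ h →
    arrow {G} (inducedArrows κ) h ≡ toward ⇔ neighbourColour κ h ℤ.< lookup κ (vertex G h)
  arrow-toward κ h = subst (λ a → a ≡ toward ⇔ neighbourColour κ h ℤ.< lookup κ (vertex G h))
    (sym (arrow-induced κ h)) (arrowFrom-toward (neighbourColour κ h) (lookup κ (vertex G h)))

  -- `Proper` tests an edge from its end `zero` only; the test from the other end follows because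
  -- acting by a sign is an involution.
  proper-neighbour : ∀ κ → Proper G κ → ∀ h → lookup κ (vertex G h) ≢ neighbourColour κ h
  proper-neighbour κ proper (e , zero)     eq = proper e eq
  proper-neighbour κ proper (e , suc zero) eq = proper e
    (trans (sym (·-involutive (sgn G e) _)) (cong (sgn G e ·_) (sym eq)))

  arrow-away : ∀ κ → Proper G κ → ∀ h →
    arrow {G} (inducedArrows κ) h ≡ away → lookup κ (vertex G h) ℤ.< neighbourColour κ h
  arrow-away κ proper h eq = arrowFrom-away (neighbourColour κ h) (lookup κ (vertex G h))
    (proper-neighbour κ proper h) (trans (sym (arrow-induced κ h)) eq)

  induced-isOrientation : ∀ κ → Proper G κ → IsOrientation G (inducedArrows κ)
  induced-isOrientation κ proper e = subst₂ (Compatible (sgn G e))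
    (sym (arrow-induced κ (e , zero))) (sym (arrow-induced κ (e , suc zero)))
    (arrowFrom-compatible (sgn G e) _ _ (proper e))

  -- The half-edge `h` may run with or against the walk; either way its far end is visited, since
  -- the walk passes through both ends of each of its edges.
  walk-other∈ : ∀ {u w} hs → IsWalk G u hs w → ∀ h → proj₁ h ∈ walkEdges G hs →
    vertex G (other G h) ∈ walkVertices G u hs
  walk-other∈ ((e , zero)     ∷ _)  _          (_ , zero)     (here refl) = there (here refl)
  walk-other∈ ((e , zero)     ∷ _)  (refl , _) (_ , suc zero) (here refl) = here refl
  walk-other∈ ((e , suc zero) ∷ _)  (refl , _) (_ , zero)     (here refl) = here refl
  walk-other∈ ((e , suc zero) ∷ _)  _          (_ , suc zero) (here refl) = there (here refl)
  walk-other∈ (_              ∷ hs) (_ , walk) h              (there e∈)  = there (walk-other∈ hs walk h e∈)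

  induced-isAcyclic : ∀ κ → Proper G κ → Acyclic G (inducedArrows κ)
  induced-isAcyclic κ proper (u , hs , walk , balanced) =
    let (h⁺ , e⁺∈ , v⁺ , a⁺) , (h⁻ , e⁻∈ , v⁻ , a⁻) = balanced v v∈
        below = subst (λ w → neighbourColour κ h⁺ ℤ.< lookup κ w) v⁺ (to (arrow-toward κ h⁺) a⁺)
        above = subst (λ w → lookup κ w ℤ.< neighbourColour κ h⁻) v⁻ (arrow-away κ proper h⁻ a⁻)
    -- The colour of `v` lies strictly between two signed neighbour colours, so one of these has
    -- larger absolute value, against the choice of `v`.
    in [ ℕ.≤⇒≯ (bounded h⁺ e⁺∈) , ℕ.≤⇒≯ (bounded h⁻ e⁻∈) ]′ (∣∣-strictly-between below above)
    where
    f : Vertex G → ℕ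
    f w = ∣ lookup κ w ∣

    targets : List (Vertex G)
    targets = map (vertex G ∘ other G) hs

    v : Vertex G
    v = argmax f u targets

    v∈ : v ∈ walkVertices G u hs
    v∈ = [ here , there ]′ (argmax-sel f u targets)

    maximal : ∀ {w} → w ∈ walkVertices G u hs → f w ℕ.≤ f v
    maximal = All.lookup {P = λ w → f w ℕ.≤ f v}
      (f[⊥]≤f[argmax] {f = f} u targets ∷ f[xs]≤f[argmax] {f = f} u targets)

    -- A sign leaves absolute values unchanged, and the far end of `h` is again on the walk, where
    -- `v` is maximal.
    bounded : ∀ h → proj₁ h ∈ walkEdges G hs → ∣ neighbourColour κ h ∣ ℕ.≤ f v
    bounded h e∈ = subst (ℕ._≤ f v) (sym (∣·∣ (sgn G (proj₁ h)) _)) (maximal (walk-other∈ hs walk h e∈))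

  -- Expansion over acyclic orientations.

  IsAcyclicOrientation : Arrows G → Set
  IsAcyclicOrientation o = IsOrientation G o × Acyclic G o

  isAcyclicOrientation? : Decidable IsAcyclicOrientation
  isAcyclicOrientation? o = isOrientation? G o ×-dec acyclic? G o

  poset : ∀ o → IsAcyclicOrientation o → SignedPoset
  poset o (orientation , acyclic) =
    record { graph = G ; arrows = o ; isOrientation = orientation ; isAcyclic = acyclic }

  -- `Preserves` and `arrow-toward` characterise `toward` by the same inequality, and knowing which
  -- arrows are `toward` fixes them all.
  preserves⇔induced : ∀ o p κ → Preserves (poset o p) κ ⇔ inducedArrows κ ≡ o
  preserves⇔induced o p κ = mk⇔
    (λ preserves → arrows-ext λ (e , s) → toward-injective (mk⇔
      (from (preserves e s) ∘ to (arrow-toward κ (e , s)))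
      (from (arrow-toward κ (e , s)) ∘ to (preserves e s))))
    (λ { refl e s → arrow-toward κ (e , s) })

  -- The decision is an explicit argument so that later proofs can generalise over it and split into
  -- cases.
  consPoset : ∀ o → Dec (IsAcyclicOrientation o) → List SignedPoset → List SignedPoset
  consPoset o (yes p) Ps = poset o p ∷ Ps
  consPoset o (no _)  Ps = Ps

  posets : List (Arrows G) → List SignedPoset
  posets []       = []
  posets (o ∷ os) = consPoset o (isAcyclicOrientation? o) (posets os)

  terms : List (Arrows G) → List (ℚ × SignedPoset)
  terms os = map (1ℚ ,_) (posets os)

  _≟ᵒ_ : DecidableEquality (Arrows G)
  _≟ᵒ_ = Vec.≡-dec (Vec.≡-dec _≟ᴬ_)

  open DecMembership _≟ᵒ_ using (_∈?_)

  -- Refines properness by a list of arrow assignments, which allows induction on `os`; for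
  -- `allArrows G` it is properness again.
  Induces : List (Arrows G) → Colouring G → Set
  Induces os κ = Proper G κ × inducedArrows κ ∈ os

  induces? : ∀ os → Decidable (Induces os)
  induces? os κ = proper? G κ ×-dec (inducedArrows κ ∈? os)

  induces-∷ : ∀ o os p κ →
    Induces (o ∷ os) κ ⇔ ((Proper G κ × Preserves (poset o p) κ) ⊎ Induces os κ)
  induces-∷ o os p κ = mk⇔
    (λ { (proper , here eq)  → inj₁ (proper , from (preserves⇔induced o p κ) eq)
       ; (proper , there o∈) → inj₂ (proper , o∈) })
    [ (λ (proper , preserves) → proper , here (to (preserves⇔induced o p κ) preserves))
    , (λ (proper , o∈) → proper , there o∈) ]′

  induces-∷-none : ∀ o os → ¬ IsAcyclicOrientation o → Induces os ≐ Induces (o ∷ os)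
  induces-∷-none o os ¬p =
    (λ (proper , o∈) → proper , there o∈) ,
    (λ { {κ} (proper , here refl) →
           contradiction (induced-isOrientation κ proper , induced-isAcyclic κ proper) ¬p
       ; (proper , there o∈) → proper , o∈ })

  sum-Y : ∀ os → Unique os →
    PowerSeries ⊢ combination PowerSeries Y (terms os) ≈ colouringSum (induces? os)
  sum-Y []       _               m = sym (colouringSum-none (induces? []) (λ κ ()) m)
  sum-Y (o ∷ os) (o∉os ∷ unique) m = step (isAcyclicOrientation? o)
    where
    step : ∀ d → proj₁ (combination PowerSeries Y (map (1ℚ ,_) (consPoset o d (posets os)))) m ≡
      proj₁ (colouringSum (induces? (o ∷ os))) m
    step (yes p) = trans
      (cong₂ ℚ._+_ (ℚ.*-identityˡ (proj₁ (Y (poset o p)) m)) (sum-Y os unique m))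
      (sym (colouringSum-⊎ (λ κ → proper? G κ ×-dec preserves? (poset o p) κ) (induces? os) (induces? (o ∷ os))
        (induces-∷ o os p)
        -- A colouring that preserves the head induces `o`, and uniqueness keeps `o` out of `os`, so
        -- no colouring is counted twice.
        (λ κ (_ , preserves) (_ , o∈) → All.lookup o∉os o∈ (sym (to (preserves⇔induced o p κ) preserves))) m))
    step (no ¬p) = trans (sum-Y os unique m)
      (colouringSum-cong (induces? os) (induces? (o ∷ os)) (induces-∷-none o os ¬p) m)

  -- By induction on `os`: the head adds 1 to both sides if it is an acyclic orientation with `k`
  -- sinks. Otherwise the filter rejects it, and on the left it gives either no term or a power of t
  -- whose coefficient at `k` is 0.
  sum-t^sink : ∀ os k → proj₁ (combination ℚ[t] (t^_ ∘ sink) (terms os)) k ≡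
    fromℕ (length (filter (isAcyclicWithSinks? G k) os))
  sum-t^sink []       k = refl
  sum-t^sink (o ∷ os) k = step (isAcyclicOrientation? o) (sinkCount G o ℕ.≟ k)
    where
    counted? : Decidable (IsAcyclicWithSinks G k)
    counted? = isAcyclicWithSinks? G k

    step : ∀ d → Dec (sinkCount G o ≡ k) →
      proj₁ (combination ℚ[t] (t^_ ∘ sink) (map (1ℚ ,_) (consPoset o d (posets os)))) k ≡
      fromℕ (length (filter counted? (o ∷ os)))
    step (no ¬p) _ = trans (sum-t^sink os k) (cong (fromℕ ∘ length)
      (sym (List.filter-reject counted? λ (orientation , acyclic , _) → ¬p (orientation , acyclic))))
    step (yes (orientation , acyclic)) (yes refl) = trans
      (cong₂ ℚ._+_ (trans (ℚ.*-identityˡ (proj₁ (t^ k) k)) (t^-same k)) (sum-t^sink os k))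
      -- `1ℚ` is `fromℕ 1` by computation, so the head's coefficient merges into the count as a
      -- successor.
      (trans (sym (fromℕ-+ 1 (length (filter counted? os))))
        (cong (fromℕ ∘ length) (sym (List.filter-accept counted? (orientation , acyclic , refl)))))
    step (yes _) (no s≢k) = trans
      (cong₂ ℚ._+_ (trans (ℚ.*-identityˡ (proj₁ (t^ (sinkCount G o)) k)) (t^-other (s≢k ∘ sym)))
        (sum-t^sink os k))
      (trans (ℚ.+-identityˡ _) (cong (fromℕ ∘ length)
        (sym (List.filter-reject counted? λ (_ , _ , s≡k) → s≢k s≡k))))

  allArrows-unique : Unique (allArrows G)
  allArrows-unique = vectors-unique (vectors-unique {xs = toward ∷ away ∷ []} (((λ ()) ∷ []) ∷ [] ∷ []) 2) (#E G)

  allArrows-complete : ∀ o → o ∈ allArrows G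
  allArrows-complete = vectors-complete (vectors-complete {xs = toward ∷ away ∷ []}
    λ { toward → here refl ; away → there (here refl) })

  X-expansion : PowerSeries ⊢ X G ≈ combination PowerSeries Y (terms (allArrows G))
  X-expansion m = trans
    (colouringSum-cong (proper? G) (induces? (allArrows G))
      ((λ {κ} proper → proper , allArrows-complete (inducedArrows κ)) , proj₁) m)
    (sym (sum-Y (allArrows G) allArrows-unique m))

theorem6p1 : (G : SignedGraph) →
    Σ (X G ∈𝕐) λ X∈𝕐 →
    (φ : ∣ 𝕐 ∣ᴹ → ∣ ℚ[t] ∣ᴹ) → IsSinkMap φ →
    ℚ[t] ⊢ φ (X G , X∈𝕐) ≈ acycPolynomial G
theorem6p1 G = X∈𝕐 , λ φ (linear , φY) k → trans
  -- The list stored in `X∈𝕐` is `terms G (allArrows G)`, so `φ` yields the same combination with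
  -- each `Y P` replaced by `t^ sink P`.
  (linear-inSpan PowerSeries ℚ[t] Y (t^_ ∘ sink) φ linear φY X∈𝕐 k)
  (sum-t^sink G (allArrows G) k)
  where
  X∈𝕐 : X G ∈𝕐
  X∈𝕐 = terms G (allArrows G) , X-expansion G
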